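{- Assume Markov's principle. Then $\mathbb{N}_\infty$ has the $\bigcirc_{\mathsf{LPO}}$ strong Myhill property: for every pair of injections $f, g : \mathbb{N}_\infty \to \mathbb{N}_\infty$ there is a bijection $h : \mathbb{N}_\infty \to \mathbb{N}_\infty$ such that, for every $x \in \mathbb{N}_\infty$, $\bigcirc_{\mathsf{LPO}}\left(\exists m \in \mathbb{Z}.\ (x,h(x)) \in R^{f,g}_m\right)$ holds.
   Context: The statement is to be proved constructively (intuitionistic set theory with powersets and $\mathbb{N}$, equivalently the internal logic of a topos with natural numbers object; neither excluded middle nor choice is assumed). $\mathbb{N}_\infty \subseteq 2^{\mathbb{N}}$ is the set of bit sequences containing at most one $1$. For $n \in \mathbb{N}$, $\underline{n} = 0^n 1 0^\omega \in \mathbb{N}_\infty$; $\underline{\mathbb{N}} = \{\underline{n} \mid n \in \mathbb{N}\}$; $\infty = 0^\omega$. Markov's principle: for every $p \in 2^{\mathbb{N}}$, if $p \neq 0^\omega$, then there exists $n \in \mathbb{N}$ with $p_n = 1$. For a proposition $p$, $\bigcirc_{\mathsf{LPO}}\, p$ is the proposition $\exists w \in \mathbb{N}_\infty.\ \big((w \in \underline{\mathbb{N}} \vee w = \infty) \Rightarrow p\big)$. For injections $f, g : X \to X$ and $m \in \mathbb{Z}$, $R^{f,g}_m \subseteq X \times X$ denotes the (graph of the) partial injection written $f \circ (g \circ f)^m$: for $m \ge 0$, $(x,y) \in R^{f,g}_m$ iff $y = f((g\circ f)^m(x))$; for $m < 0$, $(x,y) \in R^{f,g}_m$ iff $x = g((f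 \circ g)^{ -m-1}(y))$. -}

module Defs where

open import Data.Bool.Base using (Bool; true; false)
open import Data.Bool.Properties using (T-≡)
open import Data.Integer.Base using (ℤ; +_; -[1+_])
open import Data.Nat.Base using (ℕ; _≡ᵇ_)
open import Data.Nat.GeneralisedArithmetic using (fold)
open import Data.Nat.Properties using (≡ᵇ⇒≡)
open import Data.Product.Base using (Σ-syntax; ∃-syntax)
open import Data.Sum.Base using (_⊎_)
open import Function.Base using (_∘_; const)
open import Function.Bundles using (Injection; Bijection; Equivalence)
open import Level using (Level; 0ℓ; _⊔_)
open import Relation.Binary.Bundles using (Setoid)
open import Relation.Binary.Core using (Rel)
import Relation.Binary.Construct.On as On
open import Relation.Binary.PropositionalEquality using (_≡_; _≗_; _→-setoid_; sym; trans)
open import Relation.Nullary.Negation.Core using (¬_)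

private
  variable
    c ℓ : Level

-- Function extensionality is not available, so equality of bit sequences is
-- pointwise equality, and sets built from them are setoids.

MarkovPrinciple : Set
MarkovPrinciple = (p : ℕ → Bool) → ¬ (p ≗ const false) → ∃[ n ] p n ≡ true

record ℕ∞ : Set where
  constructor mkℕ∞
  field
    bit         : ℕ → Bool
    at-most-one : ∀ i j → bit i ≡ true → bit j ≡ true → i ≡ j

open ℕ∞ public

ℕ∞-setoid : Setoid 0ℓ 0ℓ
ℕ∞-setoid = On.setoid (ℕ →-setoid Bool) bit

open Setoid ℕ∞-setoid public using () renaming (_≈_ to _≈∞_)

fin : ℕ → ℕ∞
fin n .bit i = n ≡ᵇ i
fin n .at-most-one i j p q = trans (sym (index i p)) (index j q)
  where
  index : ∀ k → (n ≡ᵇ k) ≡ true → n ≡ k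
  index k = ≡ᵇ⇒≡ n k ∘ Equivalence.from T-≡

∞ : ℕ∞
∞ .bit = const false
∞ .at-most-one i j ()

IsFinite : ℕ∞ → Set
IsFinite w = ∃[ n ] w ≈∞ fin n

○LPO : Set ℓ → Set ℓ
○LPO P = Σ[ w ∈ ℕ∞ ] ((IsFinite w ⊎ w ≈∞ ∞) → P)

module _ (X : Setoid c ℓ) where

  open Setoid X using (Carrier; _≈_)

  -- The graph of the partial injection f ∘ (g ∘ f)ᵐ.  Since -[1+ n ] is
  -- m = -(n + 1), the exponent -m - 1 of the negative case is n.
  R : (f g : Injection X X) → ℤ → Rel Carrier ℓ
  R f g = graph
    where
    open Injection f using () renaming (to to f⟨_⟩)
    open Injection g using () renaming (to to g⟨_⟩)
    graph : ℤ → Rel Carrier ℓ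
    graph (+ n)    x y = y ≈ f⟨ fold x (λ z → g⟨ f⟨ z ⟩ ⟩) n ⟩
    graph -[1+ n ] x y = x ≈ g⟨ fold y (λ z → f⟨ g⟨ z ⟩ ⟩) n ⟩

  StrongMyhill : (○ : Set ℓ → Set ℓ) → Set (c ⊔ ℓ)
  StrongMyhill ○ =
    (f g : Injection X X) →
    Σ[ h ∈ Bijection X X ]
      (∀ x → ○ (∃[ m ] R f g m x (Bijection.to h x)))

{-# OPTIONS --safe #-}
module Submission where

-- Call a point isolated when equality with it is decidable.  Finite points are
-- isolated, and by Markov's principle ∞ is isolated iff LPO holds.  An injection
-- preserves isolated points: if x is isolated and x ≠ ∞, then f x and f ∞ differ
-- at some bit, so one of them is finite; and if f ∞ is finite, hence isolated,
-- then so is ∞, and LPO holds.  Therefore Myhill's back-and-forth construction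
-- works on isolated points.  It is made to cover all finite points and, as soon
-- as f ∞ or g ∞ shows a 1, also ∞.  The resulting correspondence ∼ extends to a
-- bijection h, where bit k of h x tells whether x ∼ k.  For
-- ○LPO, search for the first k at which x, f ∞ or g ∞ has a 1: if there
-- is one, x is in the domain of ∼; if there is none, then x = ∞ = f ∞ = h ∞.

open import Data.Bool.Base using (Bool; true; false; if_then_else_; _∨_; _xor_)
open import Data.Bool.Properties using (T-≡; ¬-not; ∨-zeroʳ) renaming (_≟_ to _≟ᵇ_)
open import Data.Integer.Base using (+_; -[1+_])
open import Data.List.Base using (List; []; _∷_; map; filter; length)
open import Data.List.Membership.Propositional using (_∈_; find; lose)
open import Data.List.Membership.Propositional.Properties
  using (∈-map⁺; ∈-map⁻; ∈-filter⁺; ∈-filter⁻)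
open import Data.List.Properties using (filter-notAll)
open import Data.List.Relation.Binary.Subset.Propositional using (_⊆_)
open import Data.List.Relation.Unary.Any as Any using (here; there; any?)
open import Data.Nat.Base using (ℕ; zero; suc; _≤_; _<_; s≤s⁻¹; _≤′_; ≤′-refl; ≤′-step)
open import Data.Nat.Induction using (<-rec)
open import Data.Nat.GeneralisedArithmetic using (fold)
open import Data.Nat.Properties
  using (≤-refl; ≤-trans; <-cmp; ≤-total; allUpTo?; ≡⇒≡ᵇ; ≡ᵇ⇒≡; ≤⇒≤′)
open import Data.Product.Base using (_×_; _,_; proj₁; proj₂; swap; ∃; ∃-syntax)
open import Data.Sum.Base as Sum using (_⊎_; inj₁; inj₂)
open import Function.Base using (_∘_; id)
open import Function.Bundles using (Injection; Inverse; Equivalence)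
open import Function.Properties.Inverse using (Inverse⇒Bijection)
open import Level using (Level; 0ℓ; _⊔_)
open import Relation.Binary.Bundles using (Setoid)
open import Relation.Binary.Core using (Rel)
open import Relation.Binary.Definitions using (tri<; tri≈; tri>)
open import Relation.Binary.PropositionalEquality as ≡ using (_≡_; refl)
open import Relation.Nullary.Decidable
  using (Dec; yes; no; does; map′; ¬?; dec-true; _×-dec_)
open import Relation.Nullary.Negation using (¬_; contradiction)

open import Defs

private
  variable
    c ℓ : Level

-- Chains generated by two injections on an arbitrary setoid.

module BackAndForth (X : Setoid c ℓ) where

  open Setoid X renaming (refl to ≈-refl)
  open Injection using (to; cong; injective)

  private
    variable
      f g : Injection X X
      C D : List (Carrier × Carrier)
      x x′ y y′ a b : Carrier

  -- Equivalently, `x` on the left and `y` on the right lie on one chain of the bipartite graph that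
  -- joins each left `z` to `f z` and each right `z` to `g z`.
  Linked : (f g : Injection X X) → Rel Carrier ℓ
  Linked f g x y = ∃[ m ] R X f g m x y

  -- The two clauses of `R` mirror each other: exchanging `f` with `g` and source with target turns
  -- the exponent `m` into `-m-1`.
  linked-swap : Linked f g x y → Linked g f y x
  linked-swap (+ n , p)      = -[1+ n ] , p
  linked-swap (-[1+ n ] , p) = + n , p

  fold-suc : ∀ (s : Carrier → Carrier) x n → fold (s x) s n ≡ fold x s (suc n)
  fold-suc s x zero    = refl
  fold-suc s x (suc n) = ≡.cong s (fold-suc s x n)

  fold-cong : ∀ {s} → (∀ {u v} → u ≈ v → s u ≈ s v) →
              ∀ n → x ≈ y → fold x s n ≈ fold y s n
  fold-cong s-cong zero    p = p
  fold-cong s-cong (suc n) p = s-cong (fold-cong s-cong n p)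

  linked-respˡ : x ≈ x′ → Linked f g x y → Linked f g x′ y
  linked-respˡ {f = f} {g = g} p (+ n , q) =
    + n , trans q (cong f (fold-cong (cong g ∘ cong f) n p))
  linked-respˡ p (-[1+ n ] , q) = -[1+ n ] , trans (sym p) q

  linked-respʳ : y ≈ y′ → Linked f g x y → Linked f g x y′
  linked-respʳ {f = f} {g = g} p q =
    linked-swap {f = g} {g = f} (linked-respˡ {f = g} {g = f} p (linked-swap {f = f} {g = g} q))

  module _ (f g : Injection X X) where

    private
      gf : Carrier → Carrier
      gf x = to g (to f x)

    -- Advancing the source by `g ∘ f` lowers the exponent by one. Between 0 and -1 the clause
    -- changes: `y = f x` becomes `g (f x) = g y`.
    linked-gf⁺ : Linked f g x y → Linked f g (gf x) y
    linked-gf⁺ (+ zero , p) = -[1+ 0 ] , cong g (sym p)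
    linked-gf⁺ {x = x} (+ suc n , p) =
      + n , trans p (cong f (reflexive (≡.sym (fold-suc gf x n))))
    linked-gf⁺ (-[1+ n ] , p) = -[1+ suc n ] , cong g (cong f p)

    -- The exponent goes up by one; in the negative clauses this means cancelling `g` and `f`, hence
    -- injectivity.
    linked-gf⁻ : Linked f g (gf x) y → Linked f g x y
    linked-gf⁻ {x = x} (+ n , p) = + suc n , trans p (cong f (reflexive (fold-suc gf x n)))
    linked-gf⁻ (-[1+ zero ] , p)  = + 0 , sym (injective g p)
    linked-gf⁻ (-[1+ suc n ] , p) = -[1+ n ] , injective f (injective g p)

    -- The first link makes one of `x` and `x′` an iterate of the other under `g ∘ f` (after
    -- cancelling `f` when the exponent is nonnegative), so the link to `y` is carried over one
    -- iterate at a time.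
    linked-via : Linked f g x′ (to f x) → Linked f g x′ y → Linked f g x y
    linked-via {x = x} {y = y} (+ n , p) q = linked-respˡ {f = f} {g = g} (sym (injective f p)) (shift n)
      where
      shift : ∀ n → Linked f g (fold _ gf n) y
      shift zero    = q
      shift (suc n) = linked-gf⁺ (shift n)
    linked-via {x = x} {y = y} (-[1+ n ] , p) q = unshift n (linked-respˡ {f = f} {g = g} p q)
      where
      unshift : ∀ n → Linked f g (to g (fold (to f x) (λ z → to f (to g z)) n)) y → Linked f g x y
      unshift zero    r = linked-gf⁻ r
      unshift (suc n) r = unshift n (linked-gf⁻ r)

  -- Isolated points and finite matchings between them.

  Isolated : Carrier → Set (c ⊔ ℓ)
  Isolated x = ∀ y → Dec (y ≈ x)

  isolated-resp : x ≈ y → Isolated x → Isolated y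
  isolated-resp p i z = map′ (λ q → trans q p) (λ q → trans q (sym p)) (i z)

  -- A hypothesis of the general construction; on `ℕ∞` Markov's principle supplies it, in
  -- `preserves-isolated`.
  PreservesIsolated : Injection X X → Set (c ⊔ ℓ)
  PreservesIsolated f = ∀ {x} → Isolated x → Isolated (to f x)

  isolated-reflect : (f : Injection X X) → Isolated (to f x) → Isolated x
  isolated-reflect f i y = map′ (injective f) (cong f) (i (to f y))

  -- Isolation is stored with each pair because the chain search restarts from left coordinates of
  -- `C`, and from right ones when the roles of `f` and `g` are swapped.
  record Matching (f g : Injection X X) (C : List (Carrier × Carrier)) : Set (c ⊔ ℓ) where
    field
      isolatedˡ  : (a , b) ∈ C → Isolated a
      isolatedʳ  : (a , b) ∈ C → Isolated b
      linked     : (a , b) ∈ C → Linked f g a b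
      functional : (a , b) ∈ C → (x , y) ∈ C → a ≈ x → b ≈ y
      injective′ : (a , b) ∈ C → (x , y) ∈ C → b ≈ y → a ≈ x

  open Matching

  matching-[] : Matching f g []
  matching-[] = record
    { isolatedˡ = λ () ; isolatedʳ = λ () ; linked = λ () ; functional = λ () ; injective′ = λ () }

  matching-⊆ : D ⊆ C → Matching f g C → Matching f g D
  matching-⊆ D⊆C m = record
    { isolatedˡ  = isolatedˡ m ∘ D⊆C
    ; isolatedʳ  = isolatedʳ m ∘ D⊆C
    ; linked     = linked m ∘ D⊆C
    ; functional = λ p q → functional m (D⊆C p) (D⊆C q)
    ; injective′ = λ p q → injective′ m (D⊆C p) (D⊆C q)
    }

  ∈-swap⁻ : (a , b) ∈ map swap C → (b , a) ∈ C
  ∈-swap⁻ p with ∈-map⁻ swap p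
  ... | _ , q , refl = q

  matching-swap : Matching f g C → Matching g f (map swap C)
  matching-swap {f = f} {g = g} m = record
    { isolatedˡ  = isolatedʳ m ∘ ∈-swap⁻
    ; isolatedʳ  = isolatedˡ m ∘ ∈-swap⁻
    ; linked     = linked-swap {f = f} {g = g} ∘ linked m ∘ ∈-swap⁻
    ; functional = λ p q → injective′ m (∈-swap⁻ p) (∈-swap⁻ q)
    ; injective′ = λ p q → functional m (∈-swap⁻ p) (∈-swap⁻ q)
    }

  Freshˡ Freshʳ : Carrier → List (Carrier × Carrier) → Set (c ⊔ ℓ)
  Freshˡ x C = ∀ {a b} → (a , b) ∈ C → ¬ a ≈ x
  Freshʳ y C = ∀ {a b} → (a , b) ∈ C → ¬ b ≈ y

  matching-∷ : Matching f g C → Isolated x → Isolated y → Linked f g x y →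
               Freshˡ x C → Freshʳ y C → Matching f g ((x , y) ∷ C)
  matching-∷ m ix iy l x∉C y∉C = record
    { isolatedˡ  = λ { (here refl) → ix ; (there p) → isolatedˡ m p }
    ; isolatedʳ  = λ { (here refl) → iy ; (there p) → isolatedʳ m p }
    ; linked     = λ { (here refl) → l ; (there p) → linked m p }
    ; functional = λ
      { (here refl) (here refl) _ → ≈-refl
      ; (here refl) (there q)   e → contradiction (sym e) (x∉C q)
      ; (there p)   (here refl) e → contradiction e (x∉C p)
      ; (there p)   (there q)   e → functional m p q e }
    ; injective′ = λ
      { (here refl) (here refl) _ → ≈-refl
      ; (here refl) (there q)   e → contradiction (sym e) (y∉C q)
      ; (there p)   (here refl) e → contradiction e (y∉C p)
      ; (there p)   (there q)   e → injective′ m p q e }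
    }

  -- The partner found by the search is the `f`-image of `x` or of a left coordinate of `C`;
  -- `avoids` keeps the consequence of this that the induction needs.
  record FreshPartner (f g : Injection X X) (C : List (Carrier × Carrier)) (x : Carrier) :
                      Set (c ⊔ ℓ) where
    field
      partner  : Carrier
      isolated : Isolated partner
      link     : Linked f g x partner
      fresh    : Freshʳ partner C
      avoids   : ∀ {z} → Freshˡ z C → ¬ z ≈ x → ¬ to f z ≈ partner

  open FreshPartner

  -- Follow the chain x ↦ f x ↤ x′ ↦ f x′ ↤ …, where (x′ , f x) ∈ C, dropping each
  -- used pair from C.  The field avoids ensures that a dropped value f x is not
  -- reached again.
  freshPartner : PreservesIsolated f → ∀ n → length C ≤ n → Matching f g C →
                 Isolated x → Freshˡ x C → FreshPartner f g C x
  freshPartner {f = f} {C = C} {g = g} {x = x} pf n len m ix x∉C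
    -- Since `f x` is isolated, its occurrence among the right coordinates is decidable.
    with any? (λ (_ , b) → pf ix b) C
  ... | no fx∉C = record
    { partner  = to f x
    ; isolated = pf ix
    ; link     = + 0 , ≈-refl
    ; fresh    = λ p b≈fx → fx∉C (lose p b≈fx)
    ; avoids   = λ _ z≉x fz≈fx → z≉x (injective f fz≈fx)
    }
  freshPartner {f = f} {C = []} pf zero len m ix x∉C | yes ()
  freshPartner {f = f} {C = C} {g = g} {x = x} pf (suc n) len m ix x∉C | yes fx∈C
    with find fx∈C
  ... | (x′ , y′) , x′y′∈C , y′≈fx = record
    { partner  = partner rec
    ; isolated = isolated rec
    ; link     = linked-via f g (linked-respʳ {f = f} {g = g} y′≈fx (linked m x′y′∈C)) (link rec)
    ; fresh    = fresh-C
    -- A point outside the domain of `C` differs from `x′`, which lies in that domain.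
    ; avoids   = λ z∉C _ → avoids rec (z∉C ∘ C′⊆C) (z∉C x′y′∈C ∘ sym)
    }
    where
    other? : ∀ p → Dec (¬ proj₂ p ≈ to f x)
    other? (_ , b) = ¬? (pf ix b)

    C′ : List (Carrier × Carrier)
    C′ = filter other? C

    C′⊆C : C′ ⊆ C
    C′⊆C = proj₁ ∘ ∈-filter⁻ other? {xs = C}

    x′∉C′ : Freshˡ x′ C′
    -- By functionality, a pair starting at `x′` ends at `f x`, and all such pairs have been
    -- filtered out.
    x′∉C′ p a≈x′ = proj₂ (∈-filter⁻ other? {xs = C} p)
                     (trans (functional m (C′⊆C p) x′y′∈C a≈x′) y′≈fx)

    len′ : length C′ ≤ n
    len′ = s≤s⁻¹ (≤-trans (filter-notAll other? C (Any.map (λ p q → q p) fx∈C)) len)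

    rec : FreshPartner f g C′ x′
    rec = freshPartner pf n len′ (matching-⊆ C′⊆C m) (isolatedˡ m x′y′∈C) x′∉C′

    fresh-C : Freshʳ (partner rec) C
    fresh-C {b = b} p b≈y with pf ix b
    -- Dropped pairs are handled by `avoids` at `z = x`; the remaining ones still lie in `C′`.
    ... | yes b≈fx = avoids rec (x∉C ∘ C′⊆C) (x∉C x′y′∈C ∘ sym) (trans (sym b≈fx) b≈y)
    ... | no b≉fx  = fresh rec (∈-filter⁺ other? p b≉fx) b≈y

  -- Extending a matching to cover a given isolated point on both sides.

  Extension : (f g : Injection X X) (C : List (Carrier × Carrier)) →
              (List (Carrier × Carrier) → Set (c ⊔ ℓ)) → Set (c ⊔ ℓ)
  Extension f g C P = ∃[ D ] C ⊆ D × Matching f g D × P D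

  Coversˡ Coversʳ : Carrier → List (Carrier × Carrier) → Set (c ⊔ ℓ)
  Coversˡ x C = ∃[ a ] ∃[ b ] (a , b) ∈ C × x ≈ a
  Coversʳ y C = ∃[ a ] ∃[ b ] (a , b) ∈ C × y ≈ b

  coverˡ : PreservesIsolated f → Isolated x → Matching f g C → Extension f g C (Coversˡ x)
  coverˡ {x = x} {C = C} pf ix m with any? (λ (a , _) → ix a) C
  ... | yes x∈C with find x∈C
  ...   | (a , b) , p , a≈x = C , id , m , a , b , p , sym a≈x
  coverˡ {x = x} {C = C} pf ix m | no x∉C =
    (x , partner new) ∷ C , there ,
    matching-∷ m ix (isolated new) (link new) fresh-x (fresh new) ,
    x , partner new , here refl , ≈-refl
    where
    fresh-x : Freshˡ x C
    fresh-x p a≈x = x∉C (lose p a≈x)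

    new : FreshPartner _ _ C x
    new = freshPartner pf (length C) ≤-refl m ix fresh-x

  coverʳ : PreservesIsolated g → Isolated y → Matching f g C → Extension f g C (Coversʳ y)
  coverʳ {g = g} {f = f} pg iy m with coverˡ {f = g} {g = f} pg iy (matching-swap m)
  ... | D , C⊆D , m′ , a , b , p , y≈a =
    map swap D , ∈-map⁺ swap ∘ C⊆D ∘ ∈-map⁺ swap , matching-swap m′ , b , a , ∈-map⁺ swap p , y≈a

  cover : PreservesIsolated f → PreservesIsolated g → Isolated x → Matching f g C →
          Extension f g C (λ D → Coversˡ x D × Coversʳ x D)
  cover {f = f} {g = g} pf pg ix m with coverˡ pf ix m
  ... | D , C⊆D , m′ , a , b , p , x≈a with coverʳ {g = g} {f = f} pg ix m′
  ...   | E , D⊆E , m″ , coversʳ = E , D⊆E ∘ C⊆D , m″ , (a , b , D⊆E p , x≈a) , coversʳ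

  -- The union of an increasing sequence of matchings.

  module Union {f g : Injection X X} (pf : PreservesIsolated f) (pg : PreservesIsolated g)
               {d e : ℕ → Carrier} (d-isolated : ∀ n → Isolated (d n)) (e-isolated : ∀ n → Isolated (e n))
               where

    Covers : Carrier → List (Carrier × Carrier) → Set (c ⊔ ℓ)
    Covers x C = Coversˡ x C × Coversʳ x C

    step : ∀ n → Matching f g C → Extension f g C (λ D → Covers (d n) D × Covers (e n) D)
    step n m with cover pf pg (d-isolated n) m
    ... | D , C⊆D , m′ , (a , b , p , q) , (a′ , b′ , p′ , q′) with cover pf pg (e-isolated n) m′
    ...   | E , D⊆E , m″ , e-covered =
      E , D⊆E ∘ C⊆D , m″ , ((a , b , D⊆E p , q) , (a′ , b′ , D⊆E p′ , q′)) , e-covered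

    stage : ℕ → ∃ (Matching f g)
    stage zero    = [] , matching-[]
    stage (suc n) = let D , _ , m , _ = step n (proj₂ (stage n)) in D , m

    stage-mono : ∀ {m n} → m ≤′ n → proj₁ (stage m) ⊆ proj₁ (stage n)
    stage-mono ≤′-refl           = id
    stage-mono (≤′-step {n} m≤n) = proj₁ (proj₂ (step n (proj₂ (stage n)))) ∘ stage-mono m≤n

    -- The lists hold representatives only, so the union is closed under `≈` on both sides.
    _∼_ : Rel Carrier (c ⊔ ℓ)
    x ∼ y = ∃[ n ] ∃[ a ] ∃[ b ] (a , b) ∈ proj₁ (stage n) × x ≈ a × y ≈ b

    ∼-resp : x ≈ x′ → y ≈ y′ → x ∼ y → x′ ∼ y′
    ∼-resp p q (n , a , b , r , s , t) = n , a , b , r , trans (sym p) s , trans (sym q) t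

    ∼-common : x ∼ y → x′ ∼ y′ →
               ∃[ n ] (∃[ a ] ∃[ b ] (a , b) ∈ proj₁ (stage n) × x ≈ a × y ≈ b) ×
                      (∃[ a ] ∃[ b ] (a , b) ∈ proj₁ (stage n) × x′ ≈ a × y′ ≈ b)
    ∼-common (m , a , b , p , q) (n , a′ , b′ , p′ , q′) with ≤-total m n
    ... | inj₁ m≤n = n , (a , b , stage-mono (≤⇒≤′ m≤n) p , q) , (a′ , b′ , p′ , q′)
    ... | inj₂ n≤m = m , (a , b , p , q) , (a′ , b′ , stage-mono (≤⇒≤′ n≤m) p′ , q′)

    ∼-functional : x ∼ y → x ∼ y′ → y ≈ y′
    ∼-functional r s with ∼-common r s
    ... | n , (a , b , p , x≈a , y≈b) , (a′ , b′ , p′ , x≈a′ , y′≈b′) =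
      trans y≈b (trans (functional (proj₂ (stage n)) p p′ (trans (sym x≈a) x≈a′)) (sym y′≈b′))

    ∼-injective : x ∼ y → x′ ∼ y → x ≈ x′
    ∼-injective r s with ∼-common r s
    ... | n , (a , b , p , x≈a , y≈b) , (a′ , b′ , p′ , x′≈a′ , y≈b′) =
      trans x≈a (trans (injective′ (proj₂ (stage n)) p p′ (trans (sym y≈b) y≈b′)) (sym x′≈a′))

    ∼-isolatedˡ : x ∼ y → Isolated x
    ∼-isolatedˡ (n , a , b , p , x≈a , y≈b) = isolated-resp (sym x≈a) (isolatedˡ (proj₂ (stage n)) p)

    ∼-isolatedʳ : x ∼ y → Isolated y
    ∼-isolatedʳ (n , a , b , p , x≈a , y≈b) = isolated-resp (sym y≈b) (isolatedʳ (proj₂ (stage n)) p)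

    ∼-linked : x ∼ y → Linked f g x y
    ∼-linked (n , a , b , p , x≈a , y≈b) =
      linked-respˡ {f = f} {g = g} (sym x≈a) (linked-respʳ {f = f} {g = g} (sym y≈b) (linked (proj₂ (stage n)) p))

    private
      coveredˡ : ∀ n → Coversˡ x (proj₁ (stage n)) → ∃[ y ] x ∼ y
      coveredˡ n (a , b , p , x≈a) = b , n , a , b , p , x≈a , ≈-refl

      coveredʳ : ∀ n → Coversʳ y (proj₁ (stage n)) → ∃[ x ] x ∼ y
      coveredʳ n (a , b , p , y≈b) = a , n , a , b , p , ≈-refl , y≈b

      step-covers : ∀ n → let C = proj₁ (stage (suc n)) in Covers (d n) C × Covers (e n) C
      step-covers n = let _ , _ , _ , r = step n (proj₂ (stage n)) in r

    ∼-d : ∀ n → (∃[ y ] d n ∼ y) × (∃[ x ] x ∼ d n)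
    ∼-d n = let (l , r) , _ = step-covers n in coveredˡ (suc n) l , coveredʳ (suc n) r

    ∼-e : ∀ n → (∃[ y ] e n ∼ y) × (∃[ x ] x ∼ e n)
    ∼-e n = let _ , (l , r) = step-covers n in coveredˡ (suc n) l , coveredʳ (suc n) r

-- Bits and finite points of `ℕ∞`.

bit-ext : ∀ x y → (∀ k → bit x k ≡ true → bit y k ≡ true) →
          (∀ k → bit y k ≡ true → bit x k ≡ true) → x ≈∞ y
bit-ext x y p q k with bit x k in eq | bit y k in eq′
... | true  | true  = refl
... | false | false = refl
... | true  | false = ≡.trans (≡.sym (p k eq)) eq′
... | false | true  = ≡.trans (≡.sym eq) (q k eq′)

fin-bit : ∀ k → bit (fin k) k ≡ true
fin-bit k = Equivalence.to T-≡ (≡⇒≡ᵇ k k refl)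

fin-bit⁻ : ∀ k i → bit (fin k) i ≡ true → k ≡ i
fin-bit⁻ k i = ≡ᵇ⇒≡ k i ∘ Equivalence.from T-≡

≈fin⇒bit : ∀ x k → x ≈∞ fin k → bit x k ≡ true
≈fin⇒bit x k p = ≡.trans (p k) (fin-bit k)

bit⇒≈fin : ∀ x k → bit x k ≡ true → x ≈∞ fin k
bit⇒≈fin x k p = bit-ext x (fin k)
  (λ i q → ≡.subst (λ j → bit (fin k) j ≡ true) (at-most-one x k i p q) (fin-bit k))
  (λ i q → ≡.subst (λ j → bit x j ≡ true) (fin-bit⁻ k i q) p)

finite≉∞ : ∀ x → IsFinite x → ¬ x ≈∞ ∞
finite≉∞ x (k , p) q = contradiction (≡.trans (≡.sym (≈fin⇒bit x k p)) (q k)) λ ()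

no-bits⇒≈∞ : ∀ x → (∀ k → ¬ bit x k ≡ true) → x ≈∞ ∞
no-bits⇒≈∞ x p k = ¬-not (p k)

-- Points of `ℕ∞` obtained from decidable predicates.

does⇒holds : {P : Set} (P? : Dec P) → does P? ≡ true → P
does⇒holds (yes p) _ = p

module _ {P : ℕ → Set} (P? : ∀ k → Dec (P k)) (unique : ∀ i j → P i → P j → i ≡ j) where

  fromDec : ℕ∞
  fromDec = mkℕ∞ (λ k → does (P? k)) λ i j p q →
    unique i j (does⇒holds (P? i) p) (does⇒holds (P? j) q)

  fromDec⁺ : ∀ k → P k → bit fromDec k ≡ true
  fromDec⁺ k = dec-true (P? k)

  fromDec⁻ : ∀ k → bit fromDec k ≡ true → P k
  fromDec⁻ k = does⇒holds (P? k)

module _ (p : ℕ → Bool) where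

  private
    First : ℕ → Set
    First k = p k ≡ true × (∀ {i} → i < k → ¬ p i ≡ true)

    first? : ∀ k → Dec (First k)
    first? k = (p k ≟ᵇ true) ×-dec allUpTo? (λ i → ¬? (p i ≟ᵇ true)) k

    first-unique : ∀ i j → First i → First j → i ≡ j
    first-unique i j (pi , mi) (pj , mj) with <-cmp i j
    ... | tri< i<j _ _ = contradiction pi (mj i<j)
    ... | tri≈ _ i≡j _ = i≡j
    ... | tri> _ _ j<i = contradiction pj (mi j<i)

  -- The usual retraction of all bit sequences onto `ℕ∞`: only the first one is kept.
  firstTrue : ℕ∞
  firstTrue = fromDec first? first-unique

  firstTrue-finite : IsFinite firstTrue → ∃[ k ] p k ≡ true
  firstTrue-finite (k , q) = k , proj₁ (fromDec⁻ first? first-unique k (≈fin⇒bit firstTrue k q))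

  -- By strong induction: if no earlier bit is set, a one at `k` would be the first and show up in
  -- `firstTrue`.
  firstTrue-∞ : firstTrue ≈∞ ∞ → ∀ k → ¬ p k ≡ true
  firstTrue-∞ q = <-rec _ λ k below pk →
    contradiction (≡.trans (≡.sym (fromDec⁺ first? first-unique k (pk , below))) (q k)) λ ()

-- Correspondences on `ℕ∞` and their extension to bijections.

open BackAndForth ℕ∞-setoid
open Setoid ℕ∞-setoid using () renaming (refl to ≈∞-refl; sym to ≈∞-sym; trans to ≈∞-trans)

fin-injective : ∀ i j → fin i ≈∞ fin j → i ≡ j
fin-injective i j p = ≡.sym (fin-bit⁻ j i (≡.trans (≡.sym (p i)) (fin-bit i)))

fin-isolated : ∀ k → Isolated (fin k)
fin-isolated k y = map′ (bit⇒≈fin y k) (≈fin⇒bit y k) (bit y k ≟ᵇ true)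

finite-isolated : ∀ x → IsFinite x → Isolated x
finite-isolated x (k , p) = isolated-resp {fin k} {x} (≈∞-sym {x} {fin k} p) (fin-isolated k)

-- The dichotomy `closed` rules out that `∞` is matched while some point is left without a partner.
record Correspondence (_∼_ : Rel ℕ∞ 0ℓ) : Set where
  field
    resp       : ∀ {x x′ y y′} → x ≈∞ x′ → y ≈∞ y′ → x ∼ y → x′ ∼ y′
    functional : ∀ {x y y′} → x ∼ y → x ∼ y′ → y ≈∞ y′
    injective  : ∀ {x x′ y} → x ∼ y → x′ ∼ y → x ≈∞ x′
    isolatedˡ  : ∀ {x y} → x ∼ y → Isolated x
    isolatedʳ  : ∀ {x y} → x ∼ y → Isolated y
    coversˡ    : ∀ k → ∃[ y ] fin k ∼ y
    coversʳ    : ∀ k → ∃[ x ] x ∼ fin k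
    closed     : ∀ {x y} → x ∼ y → (IsFinite x × IsFinite y) ⊎
                                   ((∀ x → ∃[ y ] x ∼ y) × (∀ y → ∃[ x ] x ∼ y))

flip-correspondence : ∀ {_∼_} → Correspondence _∼_ → Correspondence (λ x y → y ∼ x)
flip-correspondence C = record
  { resp       = λ {x} {x′} {y} {y′} p q → resp {y} {y′} {x} {x′} q p
  ; functional = λ {x} {y} {y′} → injective {y} {y′} {x}
  ; injective  = λ {x} {x′} {y} → functional {y} {x} {x′}
  ; isolatedˡ  = isolatedʳ
  ; isolatedʳ  = isolatedˡ
  ; coversˡ    = coversʳ
  ; coversʳ    = coversˡ
  ; closed     = Sum.map swap swap ∘ closed
  }
  where open Correspondence C

module Extend {_∼_ : Rel ℕ∞ 0ℓ} (C : Correspondence _∼_) where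

  open Correspondence C

  -- The partner `z` of `fin k` is unique and isolated, so it suffices to compare `x` with `z`.
  ∼fin? : ∀ x k → Dec (x ∼ fin k)
  ∼fin? x k =
    let z , z∼k = coversʳ k in
    map′ (λ p → resp {z} {x} (≈∞-sym {x} {z} p) (≈∞-refl {fin k}) z∼k) (λ q → injective q z∼k) (isolatedˡ z∼k x)

  ∼fin-unique : ∀ x i j → x ∼ fin i → x ∼ fin j → i ≡ j
  ∼fin-unique x i j p q = fin-injective i j (functional p q)

  extend : ℕ∞ → ℕ∞
  extend x = fromDec (∼fin? x) (∼fin-unique x)

  extend-bit⁺ : ∀ x k → x ∼ fin k → bit (extend x) k ≡ true
  extend-bit⁺ x = fromDec⁺ (∼fin? x) (∼fin-unique x)

  extend-bit⁻ : ∀ x k → bit (extend x) k ≡ true → x ∼ fin k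
  extend-bit⁻ x = fromDec⁻ (∼fin? x) (∼fin-unique x)

  extend-cong : ∀ x x′ → x ≈∞ x′ → extend x ≈∞ extend x′
  extend-cong x x′ p = bit-ext (extend x) (extend x′)
    (λ k q → extend-bit⁺ x′ k (resp {x} {x′} p (≈∞-refl {fin k}) (extend-bit⁻ x k q)))
    (λ k q → extend-bit⁺ x k (resp {x′} {x} (≈∞-sym {x} {x′} p) (≈∞-refl {fin k}) (extend-bit⁻ x′ k q)))

  extend-extends : ∀ x y → x ∼ y → extend x ≈∞ y
  extend-extends x y r = bit-ext (extend x) y
    (λ k p → ≈fin⇒bit y k (functional r (extend-bit⁻ x k p)))
    (λ k p → extend-bit⁺ x k (resp {x} {x} {y} (≈∞-refl {x}) (bit⇒≈fin y k p) r))

  -- If `y` is finite, the one in `extend x′` already says `x′ ∼ y`. In the other case of `closed`,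
  -- `x′` has some partner, and it must equal `y`.
  extend-reflects : ∀ x y x′ → x ∼ y → extend x′ ≈∞ y → x ≈∞ x′
  extend-reflects x y x′ r p with closed r
  ... | inj₁ (_ , k , y≈k) =
    injective (resp {x} {x} {y} (≈∞-refl {x}) y≈k r)
      (extend-bit⁻ x′ k (≈fin⇒bit (extend x′) k (≈∞-trans {extend x′} {y} {fin k} p y≈k)))
  ... | inj₂ (total , _) =
    let y′ , r′ = total x′
        y′≈y = ≈∞-trans {y′} {extend x′} {y} (≈∞-sym {extend x′} {y′} (extend-extends x′ y′ r′)) p
    in injective r (resp {x′} {x′} {y′} (≈∞-refl {x′}) y′≈y r′)

module _ {_∼_ : Rel ℕ∞ 0ℓ} (C : Correspondence _∼_) where

  private
    module C = Correspondence C
    module E = Extend C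
    module F = Extend (flip-correspondence C)

  -- Bit `k` of the left side says `fin k ∼ E.extend x`, which amounts to `x ≈∞ fin k`. The other
  -- composite follows by flipping the correspondence.
  extend-inverse : ∀ x → F.extend (E.extend x) ≈∞ x
  extend-inverse x = bit-ext (F.extend (E.extend x)) x forth back
    where
    forth : ∀ k → bit (F.extend (E.extend x)) k ≡ true → bit x k ≡ true
    forth k p = ≈fin⇒bit x k (≈∞-sym {fin k} {x}
      (E.extend-reflects (fin k) (E.extend x) x (F.extend-bit⁻ (E.extend x) k p) (≈∞-refl {E.extend x})))

    back : ∀ k → bit x k ≡ true → bit (F.extend (E.extend x)) k ≡ true
    back k p =
      let y , k∼y = C.coversˡ k
          hx≈y = ≈∞-trans {E.extend x} {E.extend (fin k)} {y}
                   (E.extend-cong x (fin k) (bit⇒≈fin x k p)) (E.extend-extends (fin k) y k∼y)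
      in F.extend-bit⁺ (E.extend x) k
           (C.resp {fin k} {fin k} {y} (≈∞-refl {fin k}) (≈∞-sym {E.extend x} {y} hx≈y) k∼y)

correspondence⇒inverse : ∀ {_∼_} → Correspondence _∼_ → Inverse ℕ∞-setoid ℕ∞-setoid
correspondence⇒inverse C = record
  { to        = E.extend
  ; from      = F.extend
  ; to-cong   = λ {x} {x′} → E.extend-cong x x′
  ; from-cong = λ {y} {y′} → F.extend-cong y y′
  ; inverse   =
      (λ {x} {y} p → ≈∞-trans {E.extend y} {E.extend (F.extend x)} {x}
        (E.extend-cong y (F.extend x) p) (extend-inverse (flip-correspondence C) x)) ,
      (λ {x} {y} p → ≈∞-trans {F.extend y} {F.extend (E.extend x)} {x}
        (F.extend-cong y (E.extend x) p) (extend-inverse C x))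
  }
  where
  module E = Extend C
  module F = Extend (flip-correspondence C)


-- Chains through `∞` when both injections fix it.

fold-∞⁺ : ∀ (s : ℕ∞ → ℕ∞) → (∀ x → x ≈∞ ∞ → s x ≈∞ ∞) → ∀ x n → x ≈∞ ∞ → fold x s n ≈∞ ∞
fold-∞⁺ s s∞ x zero    p = p
fold-∞⁺ s s∞ x (suc n) p = s∞ (fold x s n) (fold-∞⁺ s s∞ x n p)

fold-∞⁻ : ∀ (s : ℕ∞ → ℕ∞) → (∀ x → s x ≈∞ ∞ → x ≈∞ ∞) → ∀ x n → fold x s n ≈∞ ∞ → x ≈∞ ∞
fold-∞⁻ s s∞ x zero    p = p
fold-∞⁻ s s∞ x (suc n) p = fold-∞⁻ s s∞ x n (s∞ (fold x s n) p)

module _ (f : Injection ℕ∞-setoid ℕ∞-setoid) (f∞ : Injection.to f ∞ ≈∞ ∞) where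

  open Injection f

  fixes-∞⁺ : ∀ x → x ≈∞ ∞ → to x ≈∞ ∞
  fixes-∞⁺ x p = ≈∞-trans {to x} {to ∞} {∞} (cong {x} {∞} p) f∞

  fixes-∞⁻ : ∀ x → to x ≈∞ ∞ → x ≈∞ ∞
  fixes-∞⁻ x p = injective {x} {∞} (≈∞-trans {to x} {∞} {to ∞} p (≈∞-sym {to ∞} {∞} f∞))

-- Forwards `∞` stays at `∞`; backwards, injectivity leaves it no other preimage. Its chain is
-- therefore constant.
linked-∞ : ∀ (f g : Injection ℕ∞-setoid ℕ∞-setoid) → Injection.to f ∞ ≈∞ ∞ → Injection.to g ∞ ≈∞ ∞ →
           ∀ x y → Linked f g x y → x ≈∞ ∞ → y ≈∞ ∞
linked-∞ f g f∞ g∞ x y (+ n , p) x∞ = ≈∞-trans {y} {to f (fold x gf n)} {∞} p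
  (fixes-∞⁺ f f∞ (fold x gf n) (fold-∞⁺ gf (λ z → fixes-∞⁺ g g∞ (to f z) ∘ fixes-∞⁺ f f∞ z) x n x∞))
  where
  open Injection
  gf : ℕ∞ → ℕ∞
  gf z = to g (to f z)
linked-∞ f g f∞ g∞ x y (-[1+ n ] , p) x∞ =
  fold-∞⁻ fg (λ z → fixes-∞⁻ g g∞ z ∘ fixes-∞⁻ f f∞ (to g z)) y n
    (fixes-∞⁻ g g∞ (fold y fg n)
      (≈∞-trans {to g (fold y fg n)} {x} {∞} (≈∞-sym {x} {to g (fold y fg n)} p) x∞))
  where
  open Injection
  fg : ℕ∞ → ℕ∞
  fg z = to f (to g z)

-- Consequences of Markov's principle.

∨-true : ∀ a b → a ∨ b ≡ true → a ≡ true ⊎ b ≡ true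
∨-true true  b p = inj₁ refl
∨-true false b p = inj₂ p

xor-true : ∀ a b → a xor b ≡ true → a ≡ true ⊎ b ≡ true
xor-true true  b p = inj₁ refl
xor-true false b p = inj₂ p

xor-false : ∀ a b → a xor b ≡ false → a ≡ b
xor-false true  true  _ = refl
xor-false false false _ = refl

module _ (markov : MarkovPrinciple) where

  ≉∞⇒finite : ∀ x → ¬ x ≈∞ ∞ → IsFinite x
  ≉∞⇒finite x p = let k , q = markov (bit x) p in k , bit⇒≈fin x k q

  -- Markov's principle finds a bit where the two points differ; the one that has a 1 there is
  -- finite.
  ≉⇒finite : ∀ x y → ¬ x ≈∞ y → IsFinite x ⊎ IsFinite y
  ≉⇒finite x y x≉y =
    let k , p = markov (λ k → bit x k xor bit y k) (λ q → x≉y (λ k → xor-false _ _ (q k)))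
    in Sum.map (λ q → k , bit⇒≈fin x k q) (λ q → k , bit⇒≈fin y k q) (xor-true (bit x k) (bit y k) p)

  -- Isolation decides only whether `x` equals `∞`; Markov's principle turns a negative answer into
  -- the position of a 1.
  isolated-∞⇒lpo : Isolated ∞ → ∀ x → IsFinite x ⊎ x ≈∞ ∞
  isolated-∞⇒lpo i x with i x
  ... | yes x≈∞ = inj₂ x≈∞
  ... | no x≉∞  = inj₁ (≉∞⇒finite x x≉∞)

  isolated-∞⇒isolated : Isolated ∞ → ∀ x → Isolated x
  isolated-∞⇒isolated i x with isolated-∞⇒lpo i x
  ... | inj₁ x-finite = finite-isolated x x-finite
  ... | inj₂ x≈∞      = isolated-resp {∞} {x} (≈∞-sym {x} {∞} x≈∞) i

  preserves-isolated : ∀ f → PreservesIsolated f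
  preserves-isolated f {x} i with i ∞
  ... | yes ∞≈x = isolated-∞⇒isolated (isolated-resp {x} {∞} (≈∞-sym {∞} {x} ∞≈x) i) (Injection.to f x)
  ... | no ∞≉x with ≉⇒finite (Injection.to f ∞) (Injection.to f x) (∞≉x ∘ Injection.injective f {∞} {x})
  ...   | inj₁ f∞-finite = isolated-∞⇒isolated
                             (isolated-reflect {∞} f (finite-isolated (Injection.to f ∞) f∞-finite))
                             (Injection.to f x)
  ...   | inj₂ fx-finite = finite-isolated (Injection.to f x) fx-finite

  -- The correspondence of two given injections, and the modal statement.

  module Construction (f g : Injection ℕ∞-setoid ℕ∞-setoid) where

    f∞ g∞ : ℕ∞
    f∞ = Injection.to f ∞
    g∞ = Injection.to g ∞

    moved : ℕ → Bool
    moved k = bit f∞ k ∨ bit g∞ k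

    moved⇒isolated-∞ : ∀ k → moved k ≡ true → Isolated ∞
    moved⇒isolated-∞ k p with ∨-true (bit f∞ k) (bit g∞ k) p
    ... | inj₁ q = isolated-reflect {∞} f (finite-isolated f∞ (k , bit⇒≈fin f∞ k q))
    ... | inj₂ q = isolated-reflect {∞} g (finite-isolated g∞ (k , bit⇒≈fin g∞ k q))

    -- ∞ from the moment it is known to be isolated; fin k is only padding.
    spare : ℕ → ℕ∞
    spare k = if moved k then ∞ else fin k

    spare-isolated : ∀ k → Isolated (spare k)
    spare-isolated k with moved k in eq
    ... | true  = moved⇒isolated-∞ k eq
    ... | false = fin-isolated k

    open Union {f} {g} (λ {x} → preserves-isolated f {x}) (λ {x} → preserves-isolated g {x})
               {fin} {spare} fin-isolated spare-isolated

    ∼-∞ : ∀ k → moved k ≡ true → (∃[ y ] ∞ ∼ y) × (∃[ x ] x ∼ ∞)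
    -- Substituting `true` for `moved k` turns `spare k` into `∞`.
    ∼-∞ k p = ≡.subst (λ b → let z = if b then ∞ else fin k in (∃[ y ] z ∼ y) × (∃[ x ] x ∼ z)) p (∼-e k)

    Total : Set
    Total = (∀ x → ∃[ y ] x ∼ y) × (∀ y → ∃[ x ] x ∼ y)

    totalˡ : Isolated ∞ → (∃[ y ] ∞ ∼ y) → ∀ x → ∃[ y ] x ∼ y
    totalˡ i (y , r) x with isolated-∞⇒lpo i x
    ... | inj₁ (k , x≈k) = let z , s = proj₁ (∼-d k) in
                           z , ∼-resp {fin k} {x} {z} {z} (≈∞-sym {x} {fin k} x≈k) (≈∞-refl {z}) s
    ... | inj₂ x≈∞       = y , ∼-resp {∞} {x} {y} {y} (≈∞-sym {x} {∞} x≈∞) (≈∞-refl {y}) r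

    totalʳ : Isolated ∞ → (∃[ x ] x ∼ ∞) → ∀ y → ∃[ x ] x ∼ y
    totalʳ i (x , r) y with isolated-∞⇒lpo i y
    ... | inj₁ (k , y≈k) = let z , s = proj₂ (∼-d k) in
                           z , ∼-resp {z} {z} {fin k} {y} (≈∞-refl {z}) (≈∞-sym {y} {fin k} y≈k) s
    ... | inj₂ y≈∞       = x , ∼-resp {x} {x} {∞} {y} (≈∞-refl {x}) (≈∞-sym {y} {∞} y≈∞) r

    moved-total : ∀ k → moved k ≡ true → Total
    moved-total k p =
      let i = moved⇒isolated-∞ k p ; l , r = ∼-∞ k p in totalˡ i l , totalʳ i r

    unmoved : (∀ k → ¬ moved k ≡ true) → f∞ ≈∞ ∞ × g∞ ≈∞ ∞
    unmoved p =
      no-bits⇒≈∞ f∞ (λ k q → p k (≡.cong (_∨ bit g∞ k) q)) ,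
      no-bits⇒≈∞ g∞ (λ k q → p k (≡.trans (≡.cong (bit f∞ k ∨_) q) (∨-zeroʳ (bit f∞ k))))

    -- Such a pair makes `∞` isolated, so LPO decides whether `moved` has a 1. If it has none, `f`
    -- and `g` fix `∞`, the chain of `∞` is constant, and the pair is `(∞ , ∞)` itself.
    ∼-∞⇒total : ∀ x y → x ∼ y → x ≈∞ ∞ ⊎ y ≈∞ ∞ → Total
    ∼-∞⇒total x y r x∞⊎y∞ with isolated-∞⇒lpo i (firstTrue moved)
      where
      i : Isolated ∞
      i = Sum.[ (λ x∞ → isolated-resp {x} {∞} x∞ (∼-isolatedˡ {x} {y} r))
              , (λ y∞ → isolated-resp {y} {∞} y∞ (∼-isolatedʳ {x} {y} r)) ] x∞⊎y∞
    ... | inj₁ finite  = let k , p = firstTrue-finite moved finite in moved-total k p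
    ... | inj₂ never = totalˡ i (∞ , ∞∼∞) , totalʳ i (∞ , ∞∼∞)
      where
      fixed : f∞ ≈∞ ∞ × g∞ ≈∞ ∞
      fixed = unmoved (firstTrue-∞ moved never)

      x∞×y∞ : x ≈∞ ∞ × y ≈∞ ∞
      x∞×y∞ = Sum.[ (λ x∞ → x∞ , linked-∞ f g (proj₁ fixed) (proj₂ fixed) x y (∼-linked {x} {y} r) x∞)
                  , (λ y∞ → linked-∞ g f (proj₂ fixed) (proj₁ fixed) y x
                              (linked-swap {f} {g} {x} {y} (∼-linked {x} {y} r)) y∞ , y∞) ] x∞⊎y∞

      ∞∼∞ : ∞ ∼ ∞
      ∞∼∞ = ∼-resp {x} {∞} {y} {∞} (proj₁ x∞×y∞) (proj₂ x∞×y∞) r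

      i : Isolated ∞
      i = ∼-isolatedˡ {∞} {∞} ∞∼∞

    -- Both points are isolated, so each can be compared with `∞`.
    ∼-closed : ∀ x y → x ∼ y → (IsFinite x × IsFinite y) ⊎ Total
    ∼-closed x y r with ∼-isolatedˡ {x} {y} r ∞ | ∼-isolatedʳ {x} {y} r ∞
    ... | yes ∞≈x | _       = inj₂ (∼-∞⇒total x y r (inj₁ (≈∞-sym {∞} {x} ∞≈x)))
    ... | no _    | yes ∞≈y = inj₂ (∼-∞⇒total x y r (inj₂ (≈∞-sym {∞} {y} ∞≈y)))
    ... | no ∞≉x  | no ∞≉y  = inj₁ (≉∞⇒finite x (∞≉x ∘ ≈∞-sym {x} {∞}) , ≉∞⇒finite y (∞≉y ∘ ≈∞-sym {y} {∞}))

    correspondence : Correspondence _∼_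
    correspondence = record
      { resp       = λ {x} {x′} {y} {y′} → ∼-resp {x} {x′} {y} {y′}
      ; functional = λ {x} {y} {y′} → ∼-functional {x} {y} {y′}
      ; injective  = λ {x} {x′} {y} → ∼-injective {x} {y} {x′}
      ; isolatedˡ  = λ {x} {y} → ∼-isolatedˡ {x} {y}
      ; isolatedʳ  = λ {x} {y} → ∼-isolatedʳ {x} {y}
      ; coversˡ    = proj₁ ∘ ∼-d
      ; coversʳ    = proj₂ ∘ ∼-d
      ; closed     = λ {x} {y} → ∼-closed x y
      }

    open Extend correspondence using (extend; extend-extends; extend-bit⁻)

    ∼⇒linked-extend : ∀ x y → x ∼ y → Linked f g x (extend x)
    ∼⇒linked-extend x y r =
      linked-respʳ {y} {extend x} {f} {g} {x} (≈∞-sym {extend x} {y} (extend-extends x y r)) (∼-linked {x} {y} r)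

    -- Exponent 0 works, as `f x` and `extend x` are both `∞`: a 1 at `k` in `extend x` would link
    -- `∞` to `fin k`.
    ∞-linked-extend : ∀ x → x ≈∞ ∞ → (∀ k → ¬ moved k ≡ true) → Linked f g x (extend x)
    ∞-linked-extend x x∞ p =
      + 0 , ≈∞-trans {extend x} {∞} {Injection.to f x} hx∞
              (≈∞-sym {Injection.to f x} {∞} (fixes-∞⁺ f f∞≈∞ x x∞))
      where
      f∞≈∞ = proj₁ (unmoved p)
      g∞≈∞ = proj₂ (unmoved p)

      hx∞ : extend x ≈∞ ∞
      hx∞ = no-bits⇒≈∞ (extend x) λ k q → finite≉∞ (fin k) (k , ≈∞-refl {fin k})
        (linked-∞ f g f∞≈∞ g∞≈∞ x (fin k) (∼-linked {x} {fin k} (extend-bit⁻ x k q)) x∞)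

    search : ℕ∞ → ℕ → Bool
    search x k = bit x k ∨ moved k

    ○LPO-linked-extend : ∀ x → ○LPO (Linked f g x (extend x))
    ○LPO-linked-extend x = firstTrue (search x) , decided
      where
      at : ∀ k → bit x k ≡ true ⊎ moved k ≡ true → Linked f g x (extend x)
      at k (inj₁ p) =
        let y , r = proj₁ (∼-d k) in
        ∼⇒linked-extend x y
          (∼-resp {fin k} {x} {y} {y} (≈∞-sym {x} {fin k} (bit⇒≈fin x k p)) (≈∞-refl {y}) r)
      -- Here nothing is known about `x` itself, but every point has a partner.
      at k (inj₂ p) = let y , r = proj₁ (moved-total k p) x in ∼⇒linked-extend x y r

      decided : IsFinite (firstTrue (search x)) ⊎ firstTrue (search x) ≈∞ ∞ → Linked f g x (extend x)
      decided (inj₁ found) =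
        let k , p = firstTrue-finite (search x) found in at k (∨-true (bit x k) (moved k) p)
      decided (inj₂ never) =
        let none = firstTrue-∞ (search x) never in
        ∞-linked-extend x
          (no-bits⇒≈∞ x (λ k p → none k (≡.cong (_∨ moved k) p)))
          (λ k p → none k (≡.trans (≡.cong (bit x k ∨_) p) (∨-zeroʳ (bit x k))))

theorem37 : MarkovPrinciple → StrongMyhill ℕ∞-setoid ○LPO
theorem37 markov f g =
  Inverse⇒Bijection (correspondence⇒inverse correspondence) , ○LPO-linked-extend
  where open Construction markov f g
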